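{- For any constant $\nu>0$, every deterministic $\nu$-reliable spanner for the unweighted path graph $P_n$ has lightness $\Omega(n)$. (This is for any finite stretch; indeed it holds even if the spanner is only required to preserve connectivity.)
   Context: $P_n$ is the path on vertex set $X=[n]=\{1,\dots,n\}$ with unit weight edges $\{i,i+1\}$, and $d_X(i,j)=|i-j|$. The hidden constant in $\Omega(n)$ depends only on $\nu$. For a weighted graph $H$ on vertex set $X$, $d_H$ is its shortest path distance, and $H$ is dominating if $d_X(u,v)\le d_H(u,v)$ for all $u,v$. A deterministic $\nu$-reliable spanner, in the sense used here (connectivity only, which is implied by any finite stretch), is a dominating weighted graph $H$ on $X$ such that for every attack set $B\subseteq X$ there is a set $B^+\supseteq B$ with $|B^+|\le(1+\nu)|B|$ such that all the points of $X\setminus B^+$ belong to the same connected component of $H\setminus B=H[X\setminus B]$. (A $\nu$-reliable $t$-spanner requires instead $d_{H[X\setminus B]}(x,y)\le t\cdot d_X(x,y)$ for all $x,y\notin B^+$.) The lightness of $H$ is $w(H)/w(\mathrm{MST}(X))$, i.e. the total edge weight of $H$ divided by the weight of a minimum spanning tree of $(X,d_X)$, which here is $n-1$. -}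

module Defs where

open import Algebra.Bundles using (CommutativeRing)
import Algebra.Definitions.RawMonoid as RawMonoidDefinitions
open import Data.Bool.Base using (Bool; true; false; _∧_; if_then_else_)
open import Data.Fin.Base using (Fin; zero; suc; toℕ; fromℕ; inject₁)
open import Data.Fin.Properties using (_<?_)
open import Data.Fin.Subset using (Subset; _∉_; _⊆_; ∣_∣)
open import Data.Nat.Base as ℕ using (ℕ; ∣_-_∣)
open import Data.Product.Base using (_×_; ∃; ∃-syntax)
open import Function.Definitions using (Injective)
open import Level using (_⊔_) renaming (suc to lsuc)
open import Relation.Binary.Construct.Closure.ReflexiveTransitive using (Star; ε; _◅_)
open import Relation.Binary.Core using (Rel)
open import Relation.Binary.PropositionalEquality.Core using (_≡_)
open import Relation.Binary.Structures using (IsTotalOrder)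
open import Relation.Nullary.Decidable.Core using (does)
open import Relation.Nullary.Negation.Core using (¬_)

-- The standard library has no real numbers, so the scalars range over an
-- arbitrary Archimedean ordered field. The reals, with their classical
-- total order, are the intended instance; the rationals are another.

record ArchimedeanOrderedField c ℓ₁ ℓ₂ : Set (lsuc (c ⊔ ℓ₁ ⊔ ℓ₂)) where
  field
    commutativeRing : CommutativeRing c ℓ₁

  open CommutativeRing commutativeRing public

  infixl 7 _/_
  infix  8 _⁻¹
  infix  4 _≤_ _<_

  field
    0≉1          : ¬ (0# ≈ 1#)
    -- Total for convenience; the value of 0# ⁻¹ is unconstrained.
    _⁻¹          : Carrier → Carrier
    *-inverseʳ   : ∀ x → ¬ (x ≈ 0#) → x * x ⁻¹ ≈ 1#
    _≤_          : Rel Carrier ℓ₂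
    isTotalOrder : IsTotalOrder _≈_ _≤_
    +-monoʳ-≤    : ∀ z {x y} → x ≤ y → z + x ≤ z + y
    *-nonneg     : ∀ {x y} → 0# ≤ x → 0# ≤ y → 0# ≤ x * y

  _<_ : Rel Carrier (ℓ₁ ⊔ ℓ₂)
  x < y = x ≤ y × ¬ (x ≈ y)

  _/_ : Carrier → Carrier → Carrier
  x / y = x * y ⁻¹

  open RawMonoidDefinitions +-rawMonoid public using (sum) renaming (_×_ to _·_)

  ι : ℕ → Carrier
  ι n = n · 1#

  field
    archimedean : ∀ x → ∃[ n ] x ≤ ι n

record Graph (n : ℕ) : Set where
  field
    adj        : Fin n → Fin n → Bool
    adj-sym    : ∀ i j → adj i j ≡ adj j i
    adj-irrefl : ∀ i → adj i i ≡ false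

  Edge : Rel (Fin n) _
  Edge i j = adj i j ≡ true

  -- The edges of the subgraph induced on the complement of B.
  EdgeAvoiding : Subset n → Rel (Fin n) _
  EdgeAvoiding B i j = Edge i j × i ∉ B × j ∉ B

open Graph

Walk : ∀ {n} → Graph n → Rel (Fin n) _
Walk G = Star (Edge G)

Connected : ∀ {n} → Graph n → Set
Connected G = ∀ u v → Walk G u v

-- v₀, v₁, …, v₍ₖ₊₂₎ are distinct, consecutive ones are adjacent, and the
-- last is adjacent to the first.
record Cycle {n} (G : Graph n) : Set where
  field
    k        : ℕ
    v        : Fin (3 ℕ.+ k) → Fin n
    distinct : Injective _≡_ _≡_ v
    step     : ∀ (i : Fin (2 ℕ.+ k)) → Edge G (v (inject₁ i)) (v (suc i))
    close    : Edge G (v (fromℕ (2 ℕ.+ k))) (v zero)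

IsTree : ∀ {n} → Graph n → Set
IsTree G = Connected G × ¬ Cycle G

-- The path metric of P_n; the point i ∈ [n] is the element i − 1 of Fin n.
d_X : ∀ {n} → Fin n → Fin n → ℕ
d_X i j = ∣ toℕ i - toℕ j ∣

module Spanners {c ℓ₁ ℓ₂} (R : ArchimedeanOrderedField c ℓ₁ ℓ₂) where

  open ArchimedeanOrderedField R

  -- Each unordered edge {i , j} is counted once, as the pair i < j.
  sumOverEdges : ∀ {n} → Graph n → (Fin n → Fin n → Carrier) → Carrier
  sumOverEdges G w =
    sum λ i → sum λ j → if does (i <? j) ∧ adj G i j then w i j else 0#

  record WeightedGraph (n : ℕ) : Set (c ⊔ ℓ₁ ⊔ ℓ₂) where
    field
      graph         : Graph n
      weight        : Fin n → Fin n → Carrier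
      weight-sym    : ∀ {i j} → Edge graph i j → weight i j ≈ weight j i
      weight-nonneg : ∀ {i j} → Edge graph i j → 0# ≤ weight i j

    walkLength : ∀ {u v} → Walk graph u v → Carrier
    walkLength ε                    = 0#
    walkLength (_◅_ {i} {j} _ walk) = weight i j + walkLength walk

    totalWeight : Carrier
    totalWeight = sumOverEdges graph weight

  open WeightedGraph

  -- x ≤ d_H(u , v): the distance is the infimum of the lengths of the walks
  -- from u to v, and is +∞ if there are none.
  _≤Dist[_,_,_] : ∀ {n} → Carrier → WeightedGraph n → Fin n → Fin n → Set ℓ₂
  x ≤Dist[ H , u , v ] = ∀ (p : Walk (graph H) u v) → x ≤ walkLength H p

  Dominating : ∀ {n} → WeightedGraph n → Set ℓ₂
  Dominating H = ∀ u v → ι (d_X u v) ≤Dist[ H , u , v ]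

  Reliable : ∀ {n} → Carrier → WeightedGraph n → Set ℓ₂
  Reliable {n} ν H =
    ∀ (B : Subset n) → ∃[ B⁺ ]
      B ⊆ B⁺ ×
      ι ∣ B⁺ ∣ ≤ (1# + ν) * ι ∣ B ∣ ×
      (∀ x y → x ∉ B⁺ → y ∉ B⁺ → Star (EdgeAvoiding (graph H) B) x y)

  IsReliableSpanner : ∀ {n} → Carrier → WeightedGraph n → Set ℓ₂
  IsReliableSpanner ν H = Dominating H × Reliable ν H

  metricWeight : ∀ {n} → Graph n → Carrier
  metricWeight G = sumOverEdges G λ i j → ι (d_X i j)

  IsMST : ∀ {n} → Graph n → Set ℓ₂
  IsMST {n} T = IsTree T × (∀ (T′ : Graph n) → IsTree T′ → metricWeight T ≤ metricWeight T′)

  -- T is to be a minimum spanning tree; the value does not depend on which.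
  lightness : ∀ {n} → WeightedGraph n → Graph n → Carrier
  lightness H T = totalWeight H / metricWeight T

{-# OPTIONS --safe #-}
module Submission where

-- Choose a natural number K ≥ 1 + ν and split the path into a left segment of
-- a = 2Km + 1 vertices, a gap of m vertices and the remaining vertices on the
-- right, with m proportional to n. Let C be the set of left vertices that have
-- an H-edge into the right part. Attacking the gap together with C disconnects
-- left from right, so B⁺ has to contain a whole side. If |C| < m, then
-- |B⁺| ≤ 2Km < a, which is impossible; hence |C| ≥ m. Each vertex of C carries
-- its own edge, of weight at least m by domination, so H weighs at least m²,
-- whereas a minimum spanning tree weighs at most n.

open import Defs
open import Data.Bool.Base using (true; false; _∧_; if_then_else_)
import Data.Bool.Properties as Boolₚ
open import Data.Fin.Base using (Fin; zero; suc; toℕ; fromℕ; inject₁)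
open import Data.Fin.Induction using (<-weakInduction)
open import Data.Fin.Properties as Finₚ using (any?; _<?_; toℕ-inject₁; toℕ-injective)
open import Data.Fin.Subset using (Subset; inside; outside; ⊥; _∈_; _∉_; _⊆_; _∪_; ∣_∣)
open import Data.Fin.Subset.Properties using (_∈?_; ∣⊥∣≡0; ∉⊥; drop-there; p⊆q⇒∣p∣≤∣q∣; p⊆p∪q; q⊆p∪q)
open import Data.Nat.Base as ℕ using (ℕ; zero; suc; z≤n; s≤s)
open import Data.Nat.DivMod using (m/n*n≤m; m≥n⇒m/n>0; m≡m%n+[m/n]*n; m%n<n)
import Data.Nat.Properties as ℕₚ
open import Data.Nat.Solver using (module +-*-Solver)
open import Data.Product.Base using (_×_; _,_; ∃-syntax; proj₁; proj₂)
open import Data.Sum.Base using (_⊎_; inj₁; inj₂; swap)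
open import Data.Vec.Base using ([]; _∷_; here; there; tabulate)
open import Data.Vec.Properties using (lookup∘tabulate; lookup⇒[]=; []=⇒lookup)
open import Function.Base using (_∘_)
open import Level using (Level)
open import Relation.Binary.Bundles using (Poset)
open import Relation.Binary.Construct.Closure.ReflexiveTransitive using (Star; ε; _◅_; _◅◅_; reverse)
open import Relation.Binary.PropositionalEquality as ≡ using (_≡_; _≢_)
open import Relation.Binary.Structures using (IsTotalOrder)
open import Relation.Nullary using (¬_; Dec; does; yes; no; contradiction; ¬?)
open import Relation.Nullary.Decidable using (dec-true; dec-false; _×-dec_; _⊎-dec_)
open import Relation.Unary using (Decidable)
import Algebra.Properties.Ring as RingProperties
import Algebra.Properties.Semiring.Mult as Mult
import Relation.Binary.Reasoning.PartialOrder as PartialOrderReasoning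

open Graph

private variable
  p : Level
  n : ℕ

-- Finite subsets: comprehension, counting and intervals.

does⁻ : {P : Set p} (P? : Dec P) → does P? ≡ true → P
does⁻ (yes x) _ = x

select : {P : Fin n → Set p} → Decidable P → Subset n
select P? = tabulate (does ∘ P?)

∈-select⁺ : {P : Fin n → Set p} (P? : Decidable P) → ∀ {i} → P i → i ∈ select P?
∈-select⁺ P? {i} Pi =
  lookup⇒[]= i _ (≡.trans (lookup∘tabulate (does ∘ P?) i) (dec-true (P? i) Pi))

∈-select⁻ : {P : Fin n → Set p} (P? : Decidable P) → ∀ {i} → i ∈ select P? → P i
∈-select⁻ P? {i} i∈ =
  does⁻ (P? i) (≡.trans (≡.sym (lookup∘tabulate (does ∘ P?) i)) ([]=⇒lookup i∈))

∣p∪q∣≤∣p∣+∣q∣ : (p q : Subset n) → ∣ p ∪ q ∣ ℕ.≤ ∣ p ∣ ℕ.+ ∣ q ∣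
∣p∪q∣≤∣p∣+∣q∣ []            []            = z≤n
∣p∪q∣≤∣p∣+∣q∣ (inside  ∷ p) (inside  ∷ q) =
  s≤s (ℕₚ.≤-trans (∣p∪q∣≤∣p∣+∣q∣ p q) (ℕₚ.+-monoʳ-≤ ∣ p ∣ (ℕₚ.n≤1+n _)))
∣p∪q∣≤∣p∣+∣q∣ (inside  ∷ p) (outside ∷ q) = s≤s (∣p∪q∣≤∣p∣+∣q∣ p q)
∣p∪q∣≤∣p∣+∣q∣ (outside ∷ p) (inside  ∷ q) =
  ℕₚ.≤-trans (s≤s (∣p∪q∣≤∣p∣+∣q∣ p q)) (ℕₚ.≤-reflexive (≡.sym (ℕₚ.+-suc ∣ p ∣ ∣ q ∣)))
∣p∪q∣≤∣p∣+∣q∣ (outside ∷ p) (outside ∷ q) = ∣p∪q∣≤∣p∣+∣q∣ p q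

-- Supplies the survivors of an attack. Membership is decidable, so a finite search either succeeds
-- or shows `q ⊆ p`, which contradicts the sizes.
∣p∣<∣q∣⇒q⊈p : (p q : Subset n) → ∣ p ∣ ℕ.< ∣ q ∣ → ∃[ x ] x ∈ q × x ∉ p
∣p∣<∣q∣⇒q⊈p p q lt with any? (λ x → (x ∈? q) ×-dec ¬? (x ∈? p))
... | yes found = found
... | no none   = contradiction (p⊆q⇒∣p∣≤∣q∣ q⊆p) (ℕₚ.<⇒≱ lt)
  where
  q⊆p : q ⊆ p
  q⊆p {x} x∈q with x ∈? p
  ... | yes x∈p = x∈p
  ... | no x∉p  = contradiction (x , x∈q , x∉p) none

-- The i with s ≤ toℕ i < s + l, cut off at n.
interval : ℕ → ℕ → Subset n
interval {zero}  _       _       = []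
interval {suc n} (suc s) l       = outside ∷ interval s l
interval {suc n} zero    zero    = ⊥
interval {suc n} zero    (suc l) = inside ∷ interval zero l

∣interval∣≤ : ∀ s l → ∣ interval {n} s l ∣ ℕ.≤ l
∣interval∣≤ {zero}  s       l       = z≤n
∣interval∣≤ {suc n} (suc s) l       = ∣interval∣≤ {n} s l
∣interval∣≤ {suc n} zero    zero    = ℕₚ.≤-reflexive (∣⊥∣≡0 (suc n))
∣interval∣≤ {suc n} zero    (suc l) = s≤s (∣interval∣≤ {n} zero l)

-- The hypothesis keeps the cut-off at `n` from shortening the interval.
∣interval∣≥ : ∀ s l → s ℕ.+ l ℕ.≤ n → l ℕ.≤ ∣ interval {n} s l ∣
∣interval∣≥ {zero}  zero    zero    z≤n     = z≤n
∣interval∣≥ {suc n} (suc s) l       (s≤s h) = ∣interval∣≥ s l h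
∣interval∣≥ {suc n} zero    zero    _       = z≤n
∣interval∣≥ {suc n} zero    (suc l) (s≤s h) = s≤s (∣interval∣≥ zero l h)

∈-interval⁺ : ∀ s l {i : Fin n} → s ℕ.≤ toℕ i → toℕ i ℕ.< s ℕ.+ l → i ∈ interval s l
∈-interval⁺ zero    (suc l) {zero}  _       _       = here
∈-interval⁺ zero    (suc l) {suc i} _       (s≤s h) = there (∈-interval⁺ zero l z≤n h)
∈-interval⁺ (suc s) l       {suc i} (s≤s g) (s≤s h) = there (∈-interval⁺ s l g h)

∈-interval⁻ : ∀ s l {i : Fin n} → i ∈ interval s l → s ℕ.≤ toℕ i × toℕ i ℕ.< s ℕ.+ l
∈-interval⁻ {suc n} zero    zero    i∈ = contradiction i∈ ∉⊥
∈-interval⁻ {suc n} zero    (suc l) {zero}  _  = z≤n , s≤s z≤n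
∈-interval⁻ {suc n} zero    (suc l) {suc i} i∈ =
  z≤n , s≤s (proj₂ (∈-interval⁻ zero l (drop-there i∈)))
∈-interval⁻ {suc n} (suc s) l       {suc i} i∈ with ∈-interval⁻ s l (drop-there i∈)
... | g , h = s≤s g , s≤s h

-- Attacking the gap and the crossing vertices.

-- Left endpoints are recorded rather than edges: an attack deletes vertices, and distinct left
-- endpoints own distinct rows of the edge sum.
CrossesFrom : Graph n → (a b : ℕ) → Fin n → Set
CrossesFrom G a b i = toℕ i ℕ.< a × (∃[ j ] b ℕ.≤ toℕ j × Edge G i j)

crossesFrom? : (G : Graph n) → ∀ a b → Decidable (CrossesFrom G a b)
crossesFrom? G a b i =
  (toℕ i ℕₚ.<? a) ×-dec any? (λ j → (b ℕₚ.≤? toℕ j) ×-dec (adj G i j Boolₚ.≟ true))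

crossing : Graph n → (a b : ℕ) → Subset n
crossing G a b = select (crossesFrom? G a b)

-- From a left vertex, a step cannot enter the gap, which is deleted, nor land beyond it, since the
-- vertex it leaves would then be a deleted crossing vertex.
stays-left : (G : Graph n) → ∀ a m {x y : Fin n} →
  Star (EdgeAvoiding G (interval a m ∪ crossing G a (a ℕ.+ m))) x y →
  toℕ x ℕ.< a → toℕ y ℕ.< a
stays-left G a m ε x<a = x<a
stays-left G a m (_◅_ {i} {j} (ij , i∉ , j∉) walk) i<a = stays-left G a m walk j<a
  where
  j<a : toℕ j ℕ.< a
  j<a with toℕ j ℕₚ.<? a | toℕ j ℕₚ.<? a ℕ.+ m
  ... | yes j<a | _ = j<a
  ... | no j≮a | yes j<a+m =
    contradiction (p⊆p∪q _ (∈-interval⁺ a m (ℕₚ.≮⇒≥ j≮a) j<a+m)) j∉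
  ... | no _ | no j≮a+m =
    contradiction
      (q⊆p∪q (interval a m) _ (∈-select⁺ (crossesFrom? G a (a ℕ.+ m)) (i<a , j , ℕₚ.≮⇒≥ j≮a+m , ij)))
      i∉

-- Reliability with an integer factor, so that the combinatorial argument counts in `ℕ` alone.
ConnectivityReliable : ℕ → Graph n → Set
ConnectivityReliable {n} K G =
  ∀ (B : Subset n) → ∃[ B⁺ ]
    ∣ B⁺ ∣ ℕ.≤ K ℕ.* ∣ B ∣ ×
    (∀ x y → x ∉ B⁺ → y ∉ B⁺ → Star (EdgeAvoiding G B) x y)

-- Otherwise the attack that removes the gap [a , a + m) together with the
-- crossing vertices spares a vertex on either side of the gap.
∣crossing∣≥ : ∀ K a m (G : Graph n) → ConnectivityReliable K G →
  K ℕ.* (m ℕ.+ m) ℕ.< a → a ℕ.+ m ℕ.+ a ℕ.≤ n → m ℕ.≤ ∣ crossing G a (a ℕ.+ m) ∣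
∣crossing∣≥ {n} K a m G reliable small fits = ℕₚ.≮⇒≥ impossible
  where
  C = crossing G a (a ℕ.+ m)
  B = interval a m ∪ C

  impossible : ¬ (∣ C ∣ ℕ.< m)
  impossible C<m with reliable B
  ... | B⁺ , bound , conn = contradiction (stays-left G a m (conn x y x∉ y∉) x<a) (ℕₚ.≤⇒≯ a≤y)
    where
    ∣B∣≤ : ∣ B ∣ ℕ.≤ m ℕ.+ m
    ∣B∣≤ = ℕₚ.≤-trans (∣p∪q∣≤∣p∣+∣q∣ (interval a m) C)
             (ℕₚ.+-mono-≤ (∣interval∣≤ {n} a m) (ℕₚ.<⇒≤ C<m))

    ∣B⁺∣<a : ∣ B⁺ ∣ ℕ.< a
    ∣B⁺∣<a = ℕₚ.≤-<-trans (ℕₚ.≤-trans bound (ℕₚ.*-monoʳ-≤ K ∣B∣≤)) small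

    -- `B⁺` is too small to cover a window of length `a`. The windows used are `[0, a)` and
    -- `[a + m, a + m + a)`.
    survivor : ∀ s → s ℕ.+ a ℕ.≤ n → ∃[ x ] x ∈ interval s a × x ∉ B⁺
    survivor s s+a≤n =
      ∣p∣<∣q∣⇒q⊈p B⁺ (interval s a) (ℕₚ.<-≤-trans ∣B⁺∣<a (∣interval∣≥ s a s+a≤n))

    left  = survivor 0 (ℕₚ.≤-trans (ℕₚ.m≤n+m a (a ℕ.+ m)) fits)
    right = survivor (a ℕ.+ m) fits
    x = proj₁ left
    y = proj₁ right
    x∉ = proj₂ (proj₂ left)
    y∉ = proj₂ (proj₂ right)
    x<a = proj₂ (∈-interval⁻ 0 a (proj₁ (proj₂ left)))
    a≤y = ℕₚ.≤-trans (ℕₚ.m≤m+n a m) (proj₁ (∈-interval⁻ (a ℕ.+ m) a (proj₁ (proj₂ right))))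

-- The path graph is a tree.

Consecutive : ℕ → ℕ → Set
Consecutive a b = b ≡ suc a ⊎ a ≡ suc b

consecutive? : ∀ a b → Dec (Consecutive a b)
consecutive? a b = (b ℕₚ.≟ suc a) ⊎-dec (a ℕₚ.≟ suc b)

pathGraph : ∀ n → Graph n
pathGraph n = record
  { adj        = λ i j → does (consecutive? (toℕ i) (toℕ j))
  -- Here `does` computes to a Boolean disjunction, and exchanging `i` and `j` exchanges the
  -- disjuncts.
  ; adj-sym    = λ i j → Boolₚ.∨-comm (does (toℕ j ℕₚ.≟ suc (toℕ i))) _
  ; adj-irrefl = λ i → dec-false (consecutive? (toℕ i) (toℕ i)) (irrefl (toℕ i))
  }
  where
  irrefl : ∀ a → ¬ Consecutive a a
  irrefl a (inj₁ eq) = ℕₚ.1+n≢n (≡.sym eq)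
  irrefl a (inj₂ eq) = ℕₚ.1+n≢n (≡.sym eq)

pathGraph-connected : ∀ n → Connected (pathGraph n)
pathGraph-connected (suc n) u v = reverse (λ {i} {j} → ≡.trans (≡.sym (adj-sym P i j))) (from0 u) ◅◅ from0 v
  where
  P = pathGraph (suc n)

  step : ∀ i → Edge P (inject₁ i) (suc i)
  step i = dec-true (consecutive? (toℕ (inject₁ i)) (suc (toℕ i))) (inj₁ (≡.cong suc (≡.sym (toℕ-inject₁ i))))

  from0 : ∀ v → Walk P zero v
  from0 = <-weakInduction (Walk P zero) ε (λ i walk → walk ◅◅ (step i ◅ ε))

-- A walk on the integers that never turns back keeps its initial direction.
ascending : ∀ k (f : Fin (2 ℕ.+ k) → ℕ) →
  (∀ {i j} → f i ≡ f j → i ≡ j) →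
  (∀ i → Consecutive (f (inject₁ i)) (f (suc i))) →
  f (suc zero) ≡ suc (f zero) → f (fromℕ (suc k)) ≡ suc k ℕ.+ f zero
ascending zero    f inj steps up = up
ascending (suc k) f inj steps up with steps (suc zero)
-- Turning back would make the values at positions 0 and 2 equal, against injectivity.
... | inj₂ down = contradiction (inj (ℕₚ.suc-injective (≡.trans (≡.sym up) down))) λ()
... | inj₁ up′  = begin
  f (fromℕ (2 ℕ.+ k))     ≡⟨ ascending k (f ∘ suc) (λ eq → Finₚ.suc-injective (inj eq)) (λ i → steps (suc i)) up′ ⟩
  suc k ℕ.+ f (suc zero)  ≡⟨ ≡.cong (suc k ℕ.+_) up ⟩
  suc k ℕ.+ suc (f zero)  ≡⟨ ℕₚ.+-suc (suc k) (f zero) ⟩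
  2 ℕ.+ k ℕ.+ f zero      ∎
  where open ≡.≡-Reasoning

-- The mirror image of `ascending`; the first value is expressed through the last to avoid
-- subtraction.
descending : ∀ k (f : Fin (2 ℕ.+ k) → ℕ) →
  (∀ {i j} → f i ≡ f j → i ≡ j) →
  (∀ i → Consecutive (f (inject₁ i)) (f (suc i))) →
  f zero ≡ suc (f (suc zero)) → f zero ≡ suc k ℕ.+ f (fromℕ (suc k))
descending zero    f inj steps down = down
descending (suc k) f inj steps down with steps (suc zero)
... | inj₁ up    = contradiction (inj (≡.trans down (≡.sym up))) λ()
... | inj₂ down′ = ≡.trans down (≡.cong suc
  (descending k (f ∘ suc) (λ eq → Finₚ.suc-injective (inj eq)) (λ i → steps (suc i)) down′))

¬consecutive-far : ∀ {a b} k → a ≡ 2 ℕ.+ k ℕ.+ b → ¬ Consecutive a b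
¬consecutive-far {b = b} k ≡.refl (inj₁ eq) = ℕₚ.m≢1+n+m b {2 ℕ.+ k} eq
¬consecutive-far {b = b} k ≡.refl (inj₂ eq) = ℕₚ.m≢1+n+m b {k} (≡.sym (ℕₚ.suc-injective eq))

pathGraph-edge⁻ : ∀ {i j : Fin n} → Edge (pathGraph n) i j → Consecutive (toℕ i) (toℕ j)
pathGraph-edge⁻ {i = i} {j} = does⁻ (consecutive? (toℕ i) (toℕ j))

-- Read through `toℕ`, a cycle is an injective sequence with unit steps, hence monotone. Its ends
-- then differ by `2 + k`, so no closing edge can join them.
pathGraph-acyclic : ∀ n → ¬ Cycle (pathGraph n)
pathGraph-acyclic n cycle = turn (steps zero)
  where
  open Cycle cycle

  f : Fin (3 ℕ.+ k) → ℕ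
  f = toℕ ∘ v

  inj : ∀ {i j} → f i ≡ f j → i ≡ j
  inj eq = distinct (toℕ-injective eq)

  steps : ∀ i → Consecutive (f (inject₁ i)) (f (suc i))
  steps i = pathGraph-edge⁻ {i = v (inject₁ i)} {v (suc i)} (step i)

  closing : Consecutive (f (fromℕ (2 ℕ.+ k))) (f zero)
  closing = pathGraph-edge⁻ {i = v (fromℕ (2 ℕ.+ k))} {v zero} close

  turn : ¬ Consecutive (f zero) (f (suc zero))
  turn (inj₁ up)   = ¬consecutive-far k (ascending (suc k) f inj steps up) closing
  turn (inj₂ down) = ¬consecutive-far k (descending (suc k) f inj steps down) (swap closing)

pathGraph-isTree : ∀ n → IsTree (pathGraph n)
pathGraph-isTree n = pathGraph-connected n , pathGraph-acyclic n

-- Inequalities and finite sums in an ordered field.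

module OrderedField {c ℓ₁ ℓ₂} (R : ArchimedeanOrderedField c ℓ₁ ℓ₂) where

  open ArchimedeanOrderedField R hiding (zero)
  open RingProperties ring using (-‿involutive; -1*x≈-x)
  open Mult semiring using (×1-homo-*)

  poset : Poset c ℓ₁ ℓ₂
  poset = record { isPartialOrder = IsTotalOrder.isPartialOrder isTotalOrder }

  open Poset poset public using (antisym)
    renaming (refl to ≤-refl; trans to ≤-trans; reflexive to ≤-reflexive)
  open IsTotalOrder isTotalOrder using (total)
  open PartialOrderReasoning poset hiding (step-<)

  +-mono-≤ : ∀ {x y u v} → x ≤ y → u ≤ v → x + u ≤ y + v
  +-mono-≤ {x} {y} {u} {v} x≤y u≤v = begin
    x + u  ≤⟨ +-monoʳ-≤ x u≤v ⟩
    x + v  ≈⟨ +-comm x v ⟩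
    v + x  ≤⟨ +-monoʳ-≤ v x≤y ⟩
    v + y  ≈⟨ +-comm v y ⟩
    y + v  ∎

  x≤x+y : ∀ x {y} → 0# ≤ y → x ≤ x + y
  x≤x+y x {y} 0≤y = begin
    x       ≈⟨ +-identityʳ x ⟨
    x + 0#  ≤⟨ +-monoʳ-≤ x 0≤y ⟩
    x + y   ∎

  *-monoˡ-≤ : ∀ {z x y} → 0# ≤ z → x ≤ y → z * x ≤ z * y
  *-monoˡ-≤ {z} {x} {y} 0≤z x≤y = begin
    z * x                   ≤⟨ x≤x+y (z * x) (*-nonneg 0≤z 0≤y-x) ⟩
    z * x + z * (- x + y)   ≈⟨ distribˡ z x (- x + y) ⟨
    z * (x + (- x + y))     ≈⟨ *-congˡ (+-assoc x (- x) y) ⟨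
    z * (x + - x + y)       ≈⟨ *-congˡ (+-congʳ (-‿inverseʳ x)) ⟩
    z * (0# + y)            ≈⟨ *-congˡ (+-identityˡ y) ⟩
    z * y                   ∎
    where
    0≤y-x : 0# ≤ - x + y
    0≤y-x = begin
      0#       ≈⟨ -‿inverseˡ x ⟨
      - x + x  ≤⟨ +-monoʳ-≤ (- x) x≤y ⟩
      - x + y  ∎

  *-monoʳ-≤ : ∀ {z x y} → 0# ≤ z → x ≤ y → x * z ≤ y * z
  *-monoʳ-≤ {z} {x} {y} 0≤z x≤y = begin
    x * z  ≈⟨ *-comm x z ⟩
    z * x  ≤⟨ *-monoˡ-≤ 0≤z x≤y ⟩
    z * y  ≈⟨ *-comm z y ⟩
    y * z  ∎

  -- If `1# ≤ 0#`, then `- 1#` is nonnegative, and so is its square, which is `1#`.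
  0≤1 : 0# ≤ 1#
  0≤1 with total 0# 1#
  ... | inj₁ 0≤1 = 0≤1
  ... | inj₂ 1≤0 = begin
    0#           ≤⟨ *-nonneg 0≤-1 0≤-1 ⟩
    - 1# * - 1#  ≈⟨ -1*x≈-x (- 1#) ⟩
    - - 1#       ≈⟨ -‿involutive 1# ⟩
    1#           ∎
    where
    0≤-1 : 0# ≤ - 1#
    0≤-1 = begin
      0#         ≈⟨ -‿inverseˡ 1# ⟨
      - 1# + 1#  ≤⟨ +-monoʳ-≤ (- 1#) 1≤0 ⟩
      - 1# + 0#  ≈⟨ +-identityʳ (- 1#) ⟩
      - 1#       ∎

  ¬1≤0 : ¬ (1# ≤ 0#)
  ¬1≤0 1≤0 = 0≉1 (antisym 0≤1 1≤0)

  1≤x⇒x≉0 : ∀ {x} → 1# ≤ x → ¬ (x ≈ 0#)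
  1≤x⇒x≉0 1≤x x≈0 = ¬1≤0 (≤-trans 1≤x (≤-reflexive x≈0))

  ⁻¹-pos : ∀ {x} → 0# ≤ x → ¬ (x ≈ 0#) → 0# < x ⁻¹
  ⁻¹-pos {x} 0≤x x≉0 = 0≤x⁻¹ , 0≉x⁻¹
    where
    0≤x⁻¹ : 0# ≤ x ⁻¹
    0≤x⁻¹ with total 0# (x ⁻¹)
    ... | inj₁ h = h
    ... | inj₂ h = contradiction 1≤0 ¬1≤0
      where
      1≤0 : 1# ≤ 0#
      1≤0 = begin
        1#        ≈⟨ *-inverseʳ x x≉0 ⟨
        x * x ⁻¹  ≤⟨ *-monoˡ-≤ 0≤x h ⟩
        x * 0#    ≈⟨ zeroʳ x ⟩
        0#        ∎

    0≉x⁻¹ : ¬ (0# ≈ x ⁻¹)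
    0≉x⁻¹ eq = 0≉1 (trans (sym (zeroʳ x)) (trans (*-congˡ eq) (*-inverseʳ x x≉0)))

  *-≤-/ : ∀ {x y z} → 0# ≤ y → ¬ (y ≈ 0#) → x * y ≤ z → x ≤ z / y
  *-≤-/ {x} {y} {z} 0≤y y≉0 xy≤z = begin
    x                ≈⟨ *-identityʳ x ⟨
    x * 1#           ≈⟨ *-congˡ (*-inverseʳ y y≉0) ⟨
    x * (y * y ⁻¹)   ≈⟨ *-assoc x y (y ⁻¹) ⟨
    x * y * y ⁻¹     ≤⟨ *-monoʳ-≤ (proj₁ (⁻¹-pos 0≤y y≉0)) xy≤z ⟩
    z / y            ∎

  0≤ι : ∀ n → 0# ≤ ι n
  0≤ι zero    = ≤-refl
  0≤ι (suc n) = ≤-trans 0≤1 (x≤x+y 1# (0≤ι n))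

  ι-mono-≤ : ∀ {m n} → m ℕ.≤ n → ι m ≤ ι n
  ι-mono-≤ {n = n} z≤n       = 0≤ι n
  ι-mono-≤         (s≤s m≤n) = +-monoʳ-≤ 1# (ι-mono-≤ m≤n)

  ι-homo-* : ∀ m n → ι (m ℕ.* n) ≈ ι m * ι n
  ι-homo-* = ×1-homo-*

  1≤ι-suc : ∀ n → 1# ≤ ι (suc n)
  1≤ι-suc n = x≤x+y 1# (0≤ι n)

  -- Brings the cardinality bound of `Reliable`, stated in the field, back to `ℕ`.
  ι-cancel-≤ : ∀ {m n} → ι m ≤ ι n → m ℕ.≤ n
  ι-cancel-≤ {zero}  {n}     _ = z≤n
  ι-cancel-≤ {suc m} {zero}  h = contradiction (≤-trans (1≤ι-suc m) h) ¬1≤0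
  ι-cancel-≤ {suc m} {suc n} h = s≤s (ι-cancel-≤ (begin
    ι m                  ≈⟨ +-identityˡ (ι m) ⟨
    0# + ι m             ≈⟨ +-congʳ (-‿inverseˡ 1#) ⟨
    - 1# + 1# + ι m      ≈⟨ +-assoc (- 1#) 1# (ι m) ⟩
    - 1# + (1# + ι m)    ≤⟨ +-monoʳ-≤ (- 1#) h ⟩
    - 1# + (1# + ι n)    ≈⟨ +-assoc (- 1#) 1# (ι n) ⟨
    - 1# + 1# + ι n      ≈⟨ +-congʳ (-‿inverseˡ 1#) ⟩
    0# + ι n             ≈⟨ +-identityˡ (ι n) ⟩
    ι n                  ∎))

  sum-nonneg : ∀ {n} {t : Fin n → Carrier} → (∀ i → 0# ≤ t i) → 0# ≤ sum t
  sum-nonneg {zero}  t≥0 = ≤-refl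
  sum-nonneg {suc n} t≥0 = ≤-trans (t≥0 zero) (x≤x+y _ (sum-nonneg (t≥0 ∘ suc)))

  term≤sum : ∀ {n} {t : Fin n → Carrier} → (∀ i → 0# ≤ t i) → ∀ i → t i ≤ sum t
  term≤sum t≥0 zero    = x≤x+y _ (sum-nonneg (t≥0 ∘ suc))
  term≤sum {t = t} t≥0 (suc i) = begin
    t (suc i)               ≤⟨ term≤sum (t≥0 ∘ suc) i ⟩
    sum (t ∘ suc)           ≈⟨ +-identityˡ _ ⟨
    0# + sum (t ∘ suc)      ≤⟨ +-mono-≤ (t≥0 zero) ≤-refl ⟩
    t zero + sum (t ∘ suc)  ∎

  sum≤ι* : ∀ {n} {t : Fin n → Carrier} {x} → (∀ i → t i ≤ x) → sum t ≤ ι n * x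
  sum≤ι* {zero}  {x = x} t≤x = ≤-reflexive (sym (zeroˡ x))
  sum≤ι* {suc n} {t} {x} t≤x = begin
    t zero + sum (t ∘ suc)  ≤⟨ +-mono-≤ (t≤x zero) (sum≤ι* (t≤x ∘ suc)) ⟩
    x + ι n * x             ≈⟨ +-congʳ (*-identityˡ x) ⟨
    1# * x + ι n * x        ≈⟨ distribʳ x 1# (ι n) ⟨
    ι (suc n) * x           ∎

  -- Turns a heavy row for each crossing vertex into a bound on the total weight.
  ι∣p∣*x≤sum : ∀ {n} (p : Subset n) {t : Fin n → Carrier} {x} →
    (∀ i → 0# ≤ t i) → (∀ {i} → i ∈ p → x ≤ t i) → ι ∣ p ∣ * x ≤ sum t
  ι∣p∣*x≤sum []            {x = x} t≥0 x≤t = ≤-reflexive (zeroˡ x)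
  ι∣p∣*x≤sum (inside  ∷ p) {t} {x} t≥0 x≤t = begin
    ι (suc ∣ p ∣) * x       ≈⟨ distribʳ x 1# (ι ∣ p ∣) ⟩
    1# * x + ι ∣ p ∣ * x    ≈⟨ +-congʳ (*-identityˡ x) ⟩
    x + ι ∣ p ∣ * x         ≤⟨ +-mono-≤ (x≤t here) (ι∣p∣*x≤sum p (t≥0 ∘ suc) (x≤t ∘ there)) ⟩
    t zero + sum (t ∘ suc)  ∎
  ι∣p∣*x≤sum (outside ∷ p) {t} {x} t≥0 x≤t = begin
    ι ∣ p ∣ * x             ≈⟨ +-identityˡ _ ⟨
    0# + ι ∣ p ∣ * x        ≤⟨ +-mono-≤ (t≥0 zero) (ι∣p∣*x≤sum p (t≥0 ∘ suc) (x≤t ∘ there)) ⟩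
    t zero + sum (t ∘ suc)  ∎

  sum-nonpos : ∀ {n} {t : Fin n → Carrier} → (∀ i → t i ≤ 0#) → sum t ≤ 0#
  sum-nonpos {zero}  t≤0 = ≤-refl
  sum-nonpos {suc n} t≤0 =
    ≤-trans (+-mono-≤ (t≤0 zero) (sum-nonpos (t≤0 ∘ suc))) (≤-reflexive (+-identityˡ 0#))

  -- The position `k` is a natural number because it may lie out of range: the successor of the last
  -- vertex of the path does. In that case `0# ≤ x` provides the bound.
  sum-≤-supported : ∀ {n} {t : Fin n → Carrier} {x} k → 0# ≤ x →
    (∀ i → toℕ i ≡ k → t i ≤ x) → (∀ i → toℕ i ≢ k → t i ≤ 0#) → sum t ≤ x
  sum-≤-supported {zero}          k       0≤x at off = 0≤x
  sum-≤-supported {suc n} {t} {x} zero    0≤x at off = begin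
    t zero + sum (t ∘ suc)  ≤⟨ +-mono-≤ (at zero ≡.refl) (sum-nonpos (λ i → off (suc i) λ())) ⟩
    x + 0#                  ≈⟨ +-identityʳ x ⟩
    x                       ∎
  sum-≤-supported {suc n} {t} {x} (suc k) 0≤x at off = begin
    t zero + sum (t ∘ suc)  ≤⟨ +-mono-≤ (off zero λ()) (sum-≤-supported k 0≤x
                                (λ i eq → at (suc i) (≡.cong suc eq))
                                (λ i neq → off (suc i) (neq ∘ ℕₚ.suc-injective))) ⟩
    0# + x                  ≈⟨ +-identityˡ x ⟩
    x                       ∎

-- Weights of spanners and of spanning trees.

module SpannerBounds {c ℓ₁ ℓ₂} (R : ArchimedeanOrderedField c ℓ₁ ℓ₂) where

  open ArchimedeanOrderedField R hiding (zero)
  open Spanners R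
  open OrderedField R
  open WeightedGraph
  open PartialOrderReasoning poset

  -- The summand of `sumOverEdges`, named so that `sumOverEdges G w` unfolds to a sum of rows
  -- `sum (edgeTerm G w i)`.
  edgeTerm : ∀ {n} → Graph n → (Fin n → Fin n → Carrier) → Fin n → Fin n → Carrier
  edgeTerm G w i j = if does (i <? j) ∧ adj G i j then w i j else 0#

  edgeTerm-nonneg : ∀ {n} (G : Graph n) w →
    (∀ {i j} → Edge G i j → 0# ≤ w i j) → ∀ i j → 0# ≤ edgeTerm G w i j
  edgeTerm-nonneg G w w≥0 i j with does (i <? j) | adj G i j in ij
  ... | true  | true  = w≥0 ij
  ... | true  | false = ≤-refl
  ... | false | _     = ≤-refl

  edgeTerm-edge : ∀ {n} (G : Graph n) w {i j : Fin n} →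
    toℕ i ℕ.< toℕ j → Edge G i j → edgeTerm G w i j ≡ w i j
  edgeTerm-edge G w {i} {j} i<j ij rewrite dec-true (i <? j) i<j | ij = ≡.refl

  edgeTerm-nonedge : ∀ {n} (G : Graph n) w {i j : Fin n} →
    (toℕ i ℕ.< toℕ j → ¬ Edge G i j) → edgeTerm G w i j ≡ 0#
  edgeTerm-nonedge G w {i} {j} ¬edge with does (i <? j) in lt | adj G i j
  ... | true  | true  = contradiction ≡.refl (¬edge (does⁻ (i <? j) lt))
  ... | true  | false = ≡.refl
  ... | false | _     = ≡.refl

  weight≤sumOverEdges : ∀ {n} (G : Graph n) w → (∀ {i j} → Edge G i j → 0# ≤ w i j) →
    ∀ {i j} → toℕ i ℕ.< toℕ j → Edge G i j → w i j ≤ sumOverEdges G w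
  weight≤sumOverEdges G w w≥0 {i} {j} i<j ij = begin
    w i j                      ≡⟨ edgeTerm-edge G w i<j ij ⟨
    edgeTerm G w i j           ≤⟨ term≤sum (edgeTerm-nonneg G w w≥0 i) j ⟩
    sum (edgeTerm G w i)       ≤⟨ term≤sum (sum-nonneg ∘ edgeTerm-nonneg G w w≥0) i ⟩
    sumOverEdges G w           ∎

  edge-dominates : ∀ {n} (H : WeightedGraph n) → Dominating H →
    ∀ {i j} → Edge (graph H) i j → ι (d_X i j) ≤ weight H i j
  -- The walk consisting of this one edge has length `weight H i j + 0#`.
  edge-dominates H dom {i} {j} ij = ≤-trans (dom i j (ij ◅ ε)) (≤-reflexive (+-identityʳ _))

  -- An edge is counted in the row of its smaller endpoint, so the long edge at each crossing vertex
  -- lies in that vertex's own row and none is counted twice.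
  totalWeight≥ : ∀ {n} (H : WeightedGraph n) → Dominating H → ∀ a m →
    ι (∣ crossing (graph H) a (a ℕ.+ m) ∣) * ι m ≤ totalWeight H
  totalWeight≥ {n} H dom a m = ι∣p∣*x≤sum (crossing G a b) (sum-nonneg ∘ nonneg) long
    where
    G = graph H
    b = a ℕ.+ m
    nonneg : ∀ i j → 0# ≤ edgeTerm G (weight H) i j
    nonneg = edgeTerm-nonneg G (weight H) (weight-nonneg H)

    long : ∀ {i} → i ∈ crossing G a b → ι m ≤ sum (edgeTerm G (weight H) i)
    long {i} i∈ with ∈-select⁻ (crossesFrom? G a b) i∈
    ... | i<a , j , b≤j , ij = begin
      ι m                           ≤⟨ ι-mono-≤ m≤d ⟩
      ι (d_X i j)                   ≤⟨ edge-dominates H dom ij ⟩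
      weight H i j                  ≡⟨ edgeTerm-edge G (weight H) i<j ij ⟨
      edgeTerm G (weight H) i j     ≤⟨ term≤sum (nonneg i) j ⟩
      sum (edgeTerm G (weight H) i) ∎
      where
      i<j : toℕ i ℕ.< toℕ j
      i<j = ℕₚ.<-≤-trans i<a (ℕₚ.≤-trans (ℕₚ.m≤m+n a m) b≤j)

      m≤d : m ℕ.≤ d_X i j
      -- With `d = d_X i j`: `toℕ i + m ≤ a + m ≤ toℕ j ≤ toℕ i + d`.
      m≤d = ℕₚ.+-cancelˡ-≤ (toℕ i) m (d_X i j) (ℕₚ.≤-trans
        (ℕₚ.+-monoˡ-≤ m (ℕₚ.<⇒≤ i<a))
        (ℕₚ.≤-trans b≤j (ℕₚ.≤-trans (ℕₚ.m≤n+∣m-n∣ (toℕ j) (toℕ i))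
          (ℕₚ.≤-reflexive (≡.cong (toℕ i ℕ.+_) (ℕₚ.∣-∣-comm (toℕ j) (toℕ i)))))))

  -- Row `i` can only contain the edge to `i + 1`, of length 1, so each of the `n` rows contributes
  -- at most 1.
  metricWeight-pathGraph≤ : ∀ n → metricWeight (pathGraph n) ≤ ι n
  metricWeight-pathGraph≤ n = ≤-trans (sum≤ι* row) (≤-reflexive (*-identityʳ (ι n)))
    where
    d : Fin n → Fin n → Carrier
    d i j = ι (d_X i j)
    row : ∀ i → sum (edgeTerm (pathGraph n) d i) ≤ 1#
    row i = sum-≤-supported (suc (toℕ i)) 0≤1 at off
      where
      at : ∀ j → toℕ j ≡ suc (toℕ i) → edgeTerm (pathGraph n) d i j ≤ 1#
      at j j≡1+i = begin
        edgeTerm (pathGraph n) d i j ≡⟨ edgeTerm-edge (pathGraph n) d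
                                          (ℕₚ.≤-reflexive (≡.sym j≡1+i))
                                          (dec-true (consecutive? (toℕ i) (toℕ j)) (inj₁ j≡1+i)) ⟩
        ι (d_X i j)                  ≡⟨ ≡.cong ι dist ⟩
        ι 1                          ≈⟨ +-identityʳ 1# ⟩
        1#                           ∎
        where
        dist : d_X i j ≡ 1
        dist = ≡.trans
          (≡.cong (ℕ.∣ toℕ i -_∣) (≡.trans j≡1+i (ℕₚ.+-comm 1 (toℕ i))))
          (ℕₚ.∣m-m+n∣≡n (toℕ i) 1)

      ¬consecutive : ∀ j → toℕ j ≢ suc (toℕ i) → toℕ i ℕ.< toℕ j → ¬ Consecutive (toℕ i) (toℕ j)
      ¬consecutive j j≢1+i _   (inj₁ eq) = j≢1+i eq
      ¬consecutive j _     i<j (inj₂ eq) = ℕₚ.<-asym i<j (ℕₚ.≤-reflexive (≡.sym eq))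

      off : ∀ j → toℕ j ≢ suc (toℕ i) → edgeTerm (pathGraph n) d i j ≤ 0#
      off j j≢1+i = ≤-reflexive (reflexive (edgeTerm-nonedge (pathGraph n) d
        (λ i<j ij → ¬consecutive j j≢1+i i<j (pathGraph-edge⁻ {i = i} {j} ij))))

  -- Makes the denominator of the lightness positive. A walk from vertex 0 to vertex 1 must start
  -- with an edge from 0 to some `suc j`, of length at least 1.
  metricWeight-connected≥1 : ∀ {n} (G : Graph (2 ℕ.+ n)) → Connected G → 1# ≤ metricWeight G
  metricWeight-connected≥1 G conn with conn zero (suc zero)
  ... | _◅_ {j = zero} 0j _ = contradiction (≡.trans (≡.sym 0j) (adj-irrefl G zero)) λ()
  ... | _◅_ {j = suc j} 0j _ =
    ≤-trans (1≤ι-suc (toℕ j))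
      (weight≤sumOverEdges G (λ i j → ι (d_X i j)) (λ {i} {j} _ → 0≤ι (d_X i j)) (s≤s z≤n) 0j)

  reliable⇒connectivityReliable : ∀ {n ν} K → 1# + ν ≤ ι K →
    (H : WeightedGraph n) → Reliable ν H → ConnectivityReliable K (graph H)
  reliable⇒connectivityReliable {ν = ν} K 1+ν≤K H reliable B with reliable B
  ... | B⁺ , _ , bound , conn = B⁺ , ι-cancel-≤ (begin
    ι ∣ B⁺ ∣             ≤⟨ bound ⟩
    (1# + ν) * ι ∣ B ∣   ≤⟨ *-monoʳ-≤ (0≤ι ∣ B ∣) 1+ν≤K ⟩
    ι K * ι ∣ B ∣        ≈⟨ ι-homo-* K ∣ B ∣ ⟨
    ι (K ℕ.* ∣ B ∣)      ∎) , conn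

  m²≤totalWeight : ∀ {n ν} K → 1# + ν ≤ ι K → (H : WeightedGraph n) → IsReliableSpanner ν H →
    ∀ m → 1 ℕ.≤ m → m ℕ.* (3 ℕ.+ 4 ℕ.* K) ℕ.≤ n → ι (m ℕ.* m) ≤ totalWeight H
  m²≤totalWeight {n} K 1+ν≤K H (dom , reliable) m 1≤m fits = begin
    ι (m ℕ.* m)                             ≈⟨ ι-homo-* m m ⟩
    ι m * ι m                               ≤⟨ *-monoʳ-≤ (0≤ι m) (ι-mono-≤ m≤∣C∣) ⟩
    ι ∣ crossing G a (a ℕ.+ m) ∣ * ι m      ≤⟨ totalWeight≥ H dom a m ⟩
    totalWeight H                           ∎
    where
    G = graph H
    a = suc (K ℕ.* (m ℕ.+ m))

    -- Two sides and the gap take `2 + m + 4Km` vertices. Since `1 ≤ m`, the 2 is at most `2m`,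
    -- which gives the factor `3 + 4K`.
    room : a ℕ.+ m ℕ.+ a ℕ.≤ n
    room = ℕₚ.≤-trans
      (ℕₚ.≤-reflexive (solve 2 (λ k m → (con 1 :+ k :* (m :+ m)) :+ m :+ (con 1 :+ k :* (m :+ m))
                                      := con 2 :+ (m :+ con 4 :* (k :* m))) ≡.refl K m))
      (ℕₚ.≤-trans (ℕₚ.+-monoˡ-≤ (m ℕ.+ 4 ℕ.* (K ℕ.* m)) (ℕₚ.*-monoʳ-≤ 2 1≤m))
      (ℕₚ.≤-trans
        (ℕₚ.≤-reflexive (solve 2 (λ k m → con 2 :* m :+ (m :+ con 4 :* (k :* m))
                                        := m :* (con 3 :+ con 4 :* k)) ≡.refl K m))
        fits))
      where open +-*-Solver

    m≤∣C∣ : m ℕ.≤ ∣ crossing G a (a ℕ.+ m) ∣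
    m≤∣C∣ = ∣crossing∣≥ K a m G (reliable⇒connectivityReliable K 1+ν≤K H reliable) ℕₚ.≤-refl room

-- Choice of the constants and conclusion.

-- Rounding down costs at most a factor of two: the remainder is below `D`, and `D` is at most
-- `n / D * D` because the quotient is positive.
n≤2D[n/D] : ∀ n D .{{_ : ℕ.NonZero D}} → D ℕ.≤ n → n ℕ.≤ 2 ℕ.* D ℕ.* (n ℕ./ D)
n≤2D[n/D] n D D≤n = begin
  n                                 ≡⟨ m≡m%n+[m/n]*n n D ⟩
  n ℕ.% D ℕ.+ n ℕ./ D ℕ.* D         ≤⟨ ℕₚ.+-monoˡ-≤ _ (ℕₚ.<⇒≤ (m%n<n n D)) ⟩
  D ℕ.+ n ℕ./ D ℕ.* D               ≡⟨ ≡.cong (ℕ._+ n ℕ./ D ℕ.* D) (ℕₚ.*-identityˡ D) ⟨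
  1 ℕ.* D ℕ.+ n ℕ./ D ℕ.* D         ≤⟨ ℕₚ.+-monoˡ-≤ _ (ℕₚ.*-monoˡ-≤ D (m≥n⇒m/n>0 D≤n)) ⟩
  n ℕ./ D ℕ.* D ℕ.+ n ℕ./ D ℕ.* D   ≡⟨ solve 2 (λ q d → q :* d :+ q :* d := con 2 :* d :* q) ≡.refl (n ℕ./ D) D ⟩
  2 ℕ.* D ℕ.* (n ℕ./ D)             ∎
  where
  open ℕₚ.≤-Reasoning
  open +-*-Solver

theorem19 :
    ∀ {c ℓ₁ ℓ₂} (R : ArchimedeanOrderedField c ℓ₁ ℓ₂) →
    let open ArchimedeanOrderedField R
        open Spanners R
    in
    ∀ (ν : Carrier) → 0# < ν →
    ∃[ C ] 0# < C × (∃[ n₀ ]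
      (∀ (n : ℕ) → n₀ ℕ.≤ n →
       ∀ (H : WeightedGraph n) → IsReliableSpanner ν H →
       ∀ (T : Graph n) → IsMST T →
       C * ι n ≤ lightness H T))
theorem19 R ν _ = C , ⁻¹-pos (0≤ι (E ℕ.* E)) E²≉0 , D , bound
  where
  open ArchimedeanOrderedField R hiding (zero)
  open Spanners R
  open OrderedField R
  open SpannerBounds R
  open WeightedGraph
  open PartialOrderReasoning poset

  K = proj₁ (archimedean (1# + ν))
  1+ν≤K = proj₂ (archimedean (1# + ν))
  -- A gap of length `m = n / D` fits, and `n₀ = D` makes it nonempty. Then `n ≤ E * m`, so the
  -- choice of `C` as the inverse of `E * E` gives `C * n² ≤ m²`.
  D = 3 ℕ.+ 4 ℕ.* K
  E = 2 ℕ.* D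
  C = ι (E ℕ.* E) ⁻¹

  E²≉0 : ¬ (ι (E ℕ.* E) ≈ 0#)
  -- `D` starts with three successors, so `E * E` computes to the successor of its predecessor.
  E²≉0 = 1≤x⇒x≉0 (1≤ι-suc (ℕ.pred (E ℕ.* E)))

  0≤C : 0# ≤ C
  0≤C = proj₁ (⁻¹-pos (0≤ι (E ℕ.* E)) E²≉0)

  bound : ∀ n → D ℕ.≤ n → ∀ (H : WeightedGraph n) → IsReliableSpanner ν H →
          ∀ (T : Graph n) → IsMST T → C * ι n ≤ lightness H T
  -- As `D` is at least 3, there are at least two vertices, as the lower bound on `M` requires. The
  -- chain bounds one factor `M` by `n` and compares `n²` with `m²`.
  bound n@(suc (suc _)) D≤n H spanner T ((connected , _) , minimal) =
    *-≤-/ 0≤M (1≤x⇒x≉0 1≤M) (begin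
      C * ι n * M                       ≈⟨ *-assoc C (ι n) M ⟩
      C * (ι n * M)                     ≤⟨ *-monoˡ-≤ 0≤C (*-monoˡ-≤ (0≤ι n) M≤n) ⟩
      C * (ι n * ι n)                   ≈⟨ *-congˡ (ι-homo-* n n) ⟨
      C * ι (n ℕ.* n)                   ≤⟨ *-monoˡ-≤ 0≤C (ι-mono-≤ n²≤E²m²) ⟩
      C * ι (E ℕ.* E ℕ.* (m ℕ.* m))     ≈⟨ *-congˡ (ι-homo-* (E ℕ.* E) (m ℕ.* m)) ⟩
      C * (ι (E ℕ.* E) * ι (m ℕ.* m))   ≈⟨ *-assoc C (ι (E ℕ.* E)) (ι (m ℕ.* m)) ⟨
      C * ι (E ℕ.* E) * ι (m ℕ.* m)     ≈⟨ *-congʳ (trans (*-comm C _) (*-inverseʳ _ E²≉0)) ⟩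
      1# * ι (m ℕ.* m)                  ≈⟨ *-identityˡ _ ⟩
      ι (m ℕ.* m)                       ≤⟨ m²≤totalWeight K 1+ν≤K H spanner m (m≥n⇒m/n>0 D≤n) (m/n*n≤m n D) ⟩
      totalWeight H                     ∎)
    where
    m = n ℕ./ D
    M = metricWeight T

    1≤M : 1# ≤ M
    1≤M = metricWeight-connected≥1 T connected

    0≤M : 0# ≤ M
    0≤M = ≤-trans 0≤1 1≤M

    M≤n : M ≤ ι n
    -- Minimality of `T` is applied to one explicit competitor, the path itself.
    M≤n = ≤-trans (minimal (pathGraph n) (pathGraph-isTree n)) (metricWeight-pathGraph≤ n)

    n²≤E²m² : n ℕ.* n ℕ.≤ E ℕ.* E ℕ.* (m ℕ.* m)
    n²≤E²m² = ℕₚ.≤-trans (ℕₚ.*-mono-≤ n≤Em n≤Em) (ℕₚ.≤-reflexive (ℕₚ.[m*n]*[o*p]≡[m*o]*[n*p] E m E m))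
      where n≤Em = n≤2D[n/D] n D D≤n
  bound (suc zero) (s≤s ())
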